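{- Let $f$ range over $\mathbb{N}^{\mathbb{N}}$ and $\vec{x}$ over $\mathbb{N}^l$. Let $G(f,\vec{x})$ and $H(f,\vec{x},z,y)$ be basic feasible functionals and let $Q(|f|,|\vec{x}|,|y|)$ be a second order polynomial. Suppose that the functional $F(f,\vec{x},y)$ satisfies, for all $f\in\mathbb{N}^{\mathbb{N}}$, $\vec{x}\in\mathbb{N}^l$ and $y\in\mathbb{N}$: $$F(f,\vec{x},0)=G(f,\vec{x}),$$ $$F(f,\vec{x},y)=H\bigl(f,\vec{x},F(f,\vec{x},\lfloor y/2\rfloor),y\bigr)\quad\text{for } y>0,$$ $$|F(f,\vec{x},y)|\le Q(|f|,|\vec{x}|,|y|).$$ (That is, $F$ is defined from $G$ and $H$ by polynomially bounded recursion on notation with the bound $Q$.) Then $F(f,\vec{x},y)$ is a basic feasible functional.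
   Context: **Notation.** For $x\in\mathbb{N}$, $|x|$ is the length of the binary representation of $x$, with $|0|=0$; $x\# y=2^{|x|\cdot|y|}$. For $\vec{x}=(x_1,\dots,x_l)$, $|\vec{x}|=(|x_1|,\dots,|x_l|)$. A type 2 functional of rank $(k,l)$ is a (total) function $F:(\mathbb{N}^{\mathbb{N}})^k\times\mathbb{N}^l\to\mathbb{N}$. **Basic feasible functionals.** The class of basic feasible functionals is the least class of type 2 functionals that contains the functions $\mathbf{o}(x)=0$, $s_0(x)=2x$, $s_1(x)=2x+1$, $i^n_k(x_1,\dots,x_n)=x_k$, $x\# y$, and the application functional $Ap(f,x)=f(x)$, and is closed under: - *functional composition*: $F(\vec{f},\vec{x})=H(\vec{f},G_1(\vec{f},\vec{x}),\dots,G_m(\vec{f},\vec{x}),\vec{x})$; - *expansion*: $F(\vec{f},\vec{g},\vec{x},\vec{y})=G(\vec{f},\vec{x})$ (lists of arguments being understood up to order); - *limited recursion on notation* from $G,H_1,H_2,K$: $F(\vec{f},\vec{x},0)=G(\vec{f},\vec{x})$; $F(\vec{f},\vec{x},2y)=H_1(\vec{f},\vec{x},y,F(\vec{f},\vec{x},y))$ for $y>0$; $F(\vec{f},\vec{x},2y+1)=H_2(\vec{f},\vec{x},y,F(\vec{f},\vec{x},y))$; provided $|F(\vec{f},\vec{x},y)|\le|K(\vec{f},\vec{x},y)|$ for all $\vec{f},\vec{x},y$. **Second order polynomials.** For $f:\mathbb{N}\to\mathbb{N}$, the norm $|f|:\mathbb{N}\to\mathbb{N}$ is $|f|(n)=\max_{|y|\le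 n}|f(y)|$. Second order polynomials in $|f_0|,|f_1|,\dots$ and $|x_0|,|x_1|,\dots$ form the least set of terms containing the constants $n\in\mathbb{N}$ and all $|x_i|$, and such that if $P,Q$ are in the set then so are $P+Q$, $P\cdot Q$ and $|f_i|(P)$. They are evaluated with $|f_i|$ interpreted as the norm of $f_i$ and $|x_i|$ as the length of $x_i$. -}

module Defs where

open import Data.Fin using (Fin)
open import Data.Fin.Permutation using (Permutation′; _⟨$⟩ʳ_)
open import Data.List as List using (upTo)
open import Data.List.Extrema.Nat using (max)
open import Data.Nat using (ℕ; zero; suc; _+_; _*_; _^_; _≤_; _>_)
open import Data.Nat.Logarithm using (⌊log₂_⌋)
open import Data.Vec using (Vec; []; _∷_; _++_; head; lookup; tabulate; take)
open import Relation.Binary.PropositionalEquality using (_≡_)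

-- Length of the binary representation, with ∥ 0 ∥ = 0.
∥_∥ : ℕ → ℕ
∥ zero  ∥ = 0
∥ suc n ∥ = suc ⌊log₂ suc n ⌋

-- norm f n = max { ∥ f y ∥ : ∥ y ∥ ≤ n }; note ∥ y ∥ ≤ n iff y < 2 ^ n.
norm : (ℕ → ℕ) → (ℕ → ℕ)
norm f n = max 0 (List.map (λ y → ∥ f y ∥) (upTo (2 ^ n)))

-- Type 2 functionals of rank (k , l).
Functional : ℕ → ℕ → Set
Functional k l = Vec (ℕ → ℕ) k → Vec ℕ l → ℕ

smash : Functional 0 2
smash _ (x ∷ y ∷ []) = 2 ^ (∥ x ∥ * ∥ y ∥)

Ap : Functional 1 1
Ap fs xs = head fs (head xs)

permute : ∀ {A : Set} {n} → Permutation′ n → Vec A n → Vec A n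
permute π xs = tabulate (λ i → lookup xs (π ⟨$⟩ʳ i))

-- Basic feasible functionals.  Functionals are identified when they agree on
-- all arguments, which in the absence of function extensionality is imposed
-- by `resp`.  Expansion "up to order of arguments" is `expand` together with
-- `reorder`.  Every initial function has at least one number argument, and
-- hence so does every member of the class.
data BFF : ∀ {k l} → Functional k l → Set where

  resp : ∀ {k l} {F G : Functional k l} →
         (∀ fs xs → F fs xs ≡ G fs xs) → BFF F → BFF G

  o    : BFF {0} {1} (λ _ _ → 0)
  s₀   : BFF {0} {1} (λ _ xs → 2 * head xs)
  s₁   : BFF {0} {1} (λ _ xs → 2 * head xs + 1)
  proj : ∀ {n} (i : Fin n) → BFF {0} {n} (λ _ xs → lookup xs i)
  #    : BFF smash
  ap   : BFF Ap

  comp : ∀ {k l m} {H : Functional k (m + l)} {G : Fin m → Functional k l} →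
         BFF H → (∀ i → BFF (G i)) →
         BFF {k} {l} (λ fs xs → H fs (tabulate (λ i → G i fs xs) ++ xs))

  expand : ∀ {k l} k′ l′ {G : Functional k l} → BFF G →
           BFF {k + k′} {l + l′} (λ fs xs → G (take k fs) (take l xs))

  reorder : ∀ {k l} {G : Functional k l}
            (π : Permutation′ k) (ρ : Permutation′ l) → BFF G →
            BFF {k} {l} (λ fs xs → G (permute π fs) (permute ρ xs))

  limrec : ∀ {k l} {G : Functional k l} {H₁ H₂ : Functional k (l + 2)}
           {K F : Functional k (l + 1)} →
           BFF G → BFF H₁ → BFF H₂ → BFF K →
           (∀ fs xs → F fs (xs ++ 0 ∷ []) ≡ G fs xs) →
           (∀ fs xs y → y > 0 →
             F fs (xs ++ 2 * y ∷ []) ≡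
             H₁ fs (xs ++ y ∷ F fs (xs ++ y ∷ []) ∷ [])) →
           (∀ fs xs y →
             F fs (xs ++ 2 * y + 1 ∷ []) ≡
             H₂ fs (xs ++ y ∷ F fs (xs ++ y ∷ []) ∷ [])) →
           (∀ fs xs y →
             ∥ F fs (xs ++ y ∷ []) ∥ ≤ ∥ K fs (xs ++ y ∷ []) ∥) →
           BFF F

infixl 6 _⊕_
infixl 7 _⊗_

-- Second order polynomials in k function variables and l number variables;
-- `var i` stands for |xᵢ| and `app i P` for |fᵢ|(P).
data SOPoly (k l : ℕ) : Set where
  const   : ℕ → SOPoly k l
  var     : Fin l → SOPoly k l
  _⊕_ _⊗_ : SOPoly k l → SOPoly k l → SOPoly k l
  app     : Fin k → SOPoly k l → SOPoly k l

eval : ∀ {k l} → SOPoly k l → Functional k l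
eval (const n) φs ns = n
eval (var i)   φs ns = lookup ns i
eval (P ⊕ Q)   φs ns = eval P φs ns + eval Q φs ns
eval (P ⊗ Q)   φs ns = eval P φs ns * eval Q φs ns
eval (app i P) φs ns = lookup φs i (eval P φs ns)

{-# OPTIONS --safe #-}

-- The norm ∣f∣ is not feasible, so Q cannot be used directly as the bound K of
-- limited recursion.  But the recursion depends on f only through its queries,
-- so only the longest answers actually met matter.  Replace each ∣f∣ in Q by
-- the answer to a guessed query q, and run the recursion truncated at the bound
-- computed from the guesses.  Either no query met during the run contradicts the
-- guesses; then f may be set to 0 at all contradicting queries, so that Q bounds
-- the recursion for the modified f, nothing was truncated and the result is
-- right.  Or a contradicting query is found and replaces a guess, at least
-- doubling the length of its answer.  A guess has length at most r, where r is
-- determined by the outer guesses, so after r replacements its answer has length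
-- at least 2 ^ r, and that many further replacements exhaust all queries of
-- length r: two recursions on notation reach a guess that is never contradicted.
module Submission where

open import Defs
open import Data.Fin using (Fin; zero; suc; _↑ˡ_; _↑ʳ_; fromℕ<; splitAt; toℕ)
import Data.Fin.Permutation as Perm
open import Data.Fin.Properties using (pigeonhole; splitAt⁻¹-↑ˡ; splitAt⁻¹-↑ʳ; toℕ-fromℕ<; toℕ<n)
open import Data.List.Extrema.Nat using (max≤v⁺)
import Data.List.Relation.Unary.All.Properties as All
open import Data.Nat
open import Data.Nat.Logarithm using (⌊log₂_⌋; ⌊log₂⌋-mono-≤; ⌊log₂⌊n/2⌋⌋≡⌊log₂n⌋∸1; ⌊log₂[2^n]⌋≡n)
open import Data.Nat.Properties
open import Data.Product using (∃; _×_; _,_; proj₁; proj₂)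
open import Data.Sum using (_⊎_; inj₁; inj₂)
open import Data.Vec using (Vec; []; _∷_; [_]; _++_; drop; head; lookup; map; replicate; tabulate; tail; take)
open import Data.Vec.Properties using (lookup-++ˡ; lookup-++ʳ; lookup-replicate; lookup∘tabulate; tabulate-cong; tabulate∘lookup; take++drop≡id)
open import Function using (_∘_; id)
open import Relation.Binary.PropositionalEquality hiding (resp; [_])
open import Relation.Nullary using (contradiction)

private variable
  k l m n : ℕ

-- Binary notation

half-induction : (P : ℕ → Set) → P 0 → (∀ y → P ⌊ suc y /2⌋ → P (suc y)) → ∀ y → P y
half-induction P p₀ p₊ y = go y y ≤-refl
  where
  go : ∀ n y → y ≤ n → P y
  go _       zero    _         = p₀
  go (suc n) (suc y) (s≤s y≤n) = p₊ y (go n ⌊ suc y /2⌋ (≤-trans (s≤s⁻¹ (⌊n/2⌋<n y)) y≤n))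

half-2* : ∀ y → ⌊ 2 * y /2⌋ ≡ y
half-2* y = trans (cong (λ z → ⌊ y + z /2⌋) (+-identityʳ y)) (sym (n≡⌊n+n/2⌋ y))

half-1+2* : ∀ y → ⌊ 1 + 2 * y /2⌋ ≡ y
half-1+2* zero    = refl
half-1+2* (suc y) rewrite +-identityʳ y | +-suc y y =
  cong suc (subst (λ z → ⌊ suc (y + z) /2⌋ ≡ y) (+-identityʳ y) (half-1+2* y))

odd : ℕ → ℕ
odd zero          = 0
odd (suc zero)    = 1
odd (suc (suc n)) = odd n

odd-2* : ∀ y → odd (2 * y) ≡ 0
odd-2* zero = refl
odd-2* (suc y) rewrite +-suc y (y + 0) = odd-2* y

odd-1+2* : ∀ y → odd (1 + 2 * y) ≡ 1
odd-1+2* zero = refl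
odd-1+2* (suc y) rewrite +-suc y (y + 0) = odd-1+2* y

∥suc∥ : ∀ y → ∥ suc y ∥ ≡ suc ∥ ⌊ suc y /2⌋ ∥
∥suc∥ zero    = refl
∥suc∥ (suc y) = cong suc (begin
  ⌊log₂ 2+ y ⌋                  ≡⟨ m∸n+n≡m (⌊log₂⌋-mono-≤ {2} {2+ y} (s≤s (s≤s z≤n))) ⟨
  ⌊log₂ 2+ y ⌋ ∸ 1 + 1          ≡⟨ cong (_+ 1) (⌊log₂⌊n/2⌋⌋≡⌊log₂n⌋∸1 (2+ y)) ⟨
  ⌊log₂ suc ⌊ y /2⌋ ⌋ + 1       ≡⟨ +-comm _ 1 ⟩
  suc ⌊log₂ suc ⌊ y /2⌋ ⌋       ∎)
  where
  open ≡-Reasoning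

∥half∥ : ∀ y → ∥ ⌊ y /2⌋ ∥ ≡ ∥ y ∥ ∸ 1
∥half∥ zero    = refl
∥half∥ (suc y) = sym (cong (_∸ 1) (∥suc∥ y))

∥1+2*∥ : ∀ y → ∥ 1 + 2 * y ∥ ≡ suc ∥ y ∥
∥1+2*∥ y = trans (∥suc∥ (2 * y)) (cong (λ z → suc ∥ z ∥) (half-1+2* y))

∥2^∥ : ∀ n → ∥ 2 ^ n ∥ ≡ suc n
∥2^∥ n with 2 ^ n | m^n>0 2 n | ⌊log₂[2^n]⌋≡n n
... | suc _ | _ | eq = cong suc eq

∥∥-mono : ∀ {m n} → m ≤ n → ∥ m ∥ ≤ ∥ n ∥
∥∥-mono {zero}          _   = z≤n
∥∥-mono {suc m} {suc n} m≤n = s≤s (⌊log₂⌋-mono-≤ m≤n)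

∥∥≡0 : ∀ {n} → ∥ n ∥ ≡ 0 → n ≡ 0
∥∥≡0 {zero} _ = refl

∥∥≤⇒<2^ : ∀ {y n} → ∥ y ∥ ≤ n → y < 2 ^ n
∥∥≤⇒<2^ {y} {n} ∥y∥≤n = ≰⇒> λ 2^n≤y →
  <-irrefl refl (≤-trans (subst (_≤ ∥ y ∥) (∥2^∥ n) (∥∥-mono 2^n≤y)) ∥y∥≤n)

<2^⇒∥∥≤ : ∀ {y n} → y < 2 ^ n → ∥ y ∥ ≤ n
<2^⇒∥∥≤ {y} {n} y<2^n = ≮⇒≥ λ n<∥y∥ → <-irrefl refl (≤-trans y<2^n (go n y n<∥y∥))
  where
  go : ∀ n y → n < ∥ y ∥ → 2 ^ n ≤ y
  go zero    (suc y) _     = s≤s z≤n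
  go (suc n) (suc y) n<∥y∥ = begin
    2 * 2 ^ n           ≤⟨ *-monoʳ-≤ 2 (go n _ (s≤s⁻¹ (subst (suc n <_) (∥suc∥ y) n<∥y∥))) ⟩
    2 * ⌊ suc y /2⌋     ≡⟨ cong (⌊ suc y /2⌋ +_) (+-identityʳ _) ⟩
    ⌊ suc y /2⌋ + ⌊ suc y /2⌋ ≤⟨ +-monoʳ-≤ ⌊ suc y /2⌋ (⌊n/2⌋≤⌈n/2⌉ (suc y)) ⟩
    ⌊ suc y /2⌋ + ⌈ suc y /2⌉ ≡⟨ ⌊n/2⌋+⌈n/2⌉≡n (suc y) ⟩
    suc y               ∎
    where open ≤-Reasoning

-- Case distinction and recursion on notation.

ite : ℕ → ℕ → ℕ → ℕ
ite zero    a b = a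
ite (suc _) a b = b

ite-zero : ∀ {c a b} → c ≡ 0 → ite c a b ≡ a
ite-zero refl = refl

-- The third argument is fuel that makes the recursion structural; `y` units suffice because halving
-- lowers every positive number.
brec-fuel : (ℕ → ℕ → ℕ) → ℕ → ℕ → ℕ → ℕ
brec-fuel s i _       zero    = i
brec-fuel s i zero    (suc _) = i
brec-fuel s i (suc n) (suc y) = s (suc y) (brec-fuel s i n ⌊ suc y /2⌋)

brec : (ℕ → ℕ → ℕ) → ℕ → ℕ → ℕ
brec s i y = brec-fuel s i y y

brec-suc : ∀ s i y → brec s i (suc y) ≡ s (suc y) (brec s i ⌊ suc y /2⌋)
brec-suc s i y = cong (s (suc y)) (fuel y _ _ (s≤s⁻¹ (⌊n/2⌋<n y)) ≤-refl)
  where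
  fuel : ∀ n m y → y ≤ n → y ≤ m → brec-fuel s i n y ≡ brec-fuel s i m y
  fuel _       _       zero    _         _         = refl
  fuel (suc n) (suc m) (suc y) (s≤s y≤n) (s≤s y≤m) =
    cong (s (suc y)) (fuel n m _ (≤-trans h≤y y≤n) (≤-trans h≤y y≤m))
    where h≤y = s≤s⁻¹ (⌊n/2⌋<n y)

-- shiftʳ a b = ⌊ a / 2 ^ ∥ b ∥ ⌋ compares lengths, since its length is ∥ a ∥ ∸ ∥ b ∥.
shiftʳ : ℕ → ℕ → ℕ
shiftʳ a = brec (λ _ v → ⌊ v /2⌋) a

∥shiftʳ∥ : ∀ a b → ∥ shiftʳ a b ∥ ≡ ∥ a ∥ ∸ ∥ b ∥
∥shiftʳ∥ a = half-induction _ refl λ y ih → begin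
  ∥ shiftʳ a (suc y) ∥               ≡⟨ cong ∥_∥ (brec-suc (λ _ v → ⌊ v /2⌋) a y) ⟩
  ∥ ⌊ shiftʳ a ⌊ suc y /2⌋ /2⌋ ∥     ≡⟨ ∥half∥ (shiftʳ a ⌊ suc y /2⌋) ⟩
  ∥ shiftʳ a ⌊ suc y /2⌋ ∥ ∸ 1       ≡⟨ cong (_∸ 1) ih ⟩
  ∥ a ∥ ∸ ∥ ⌊ suc y /2⌋ ∥ ∸ 1        ≡⟨ ∸-+-assoc ∥ a ∥ ∥ ⌊ suc y /2⌋ ∥ 1 ⟩
  ∥ a ∥ ∸ (∥ ⌊ suc y /2⌋ ∥ + 1)      ≡⟨ cong (∥ a ∥ ∸_) (trans (+-comm ∥ ⌊ suc y /2⌋ ∥ 1) (sym (∥suc∥ y))) ⟩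
  ∥ a ∥ ∸ ∥ suc y ∥                  ∎
  where open ≡-Reasoning

shiftʳ≡0⇒≤ : ∀ {a b} → shiftʳ a b ≡ 0 → ∥ a ∥ ≤ ∥ b ∥
shiftʳ≡0⇒≤ {a} {b} eq = m∸n≡0⇒m≤n (trans (sym (∥shiftʳ∥ a b)) (cong ∥_∥ eq))

≤⇒shiftʳ≡0 : ∀ {a b} → ∥ a ∥ ≤ ∥ b ∥ → shiftʳ a b ≡ 0
≤⇒shiftʳ≡0 {a} {b} a≤b = ∥∥≡0 (trans (∥shiftʳ∥ a b) (m≤n⇒m∸n≡0 a≤b))

shiftʳ≢0⇒> : ∀ {a b n} → shiftʳ a b ≡ suc n → ∥ b ∥ < ∥ a ∥
shiftʳ≢0⇒> {a} {b} eq = ≰⇒> λ a≤b → contradiction (trans (sym eq) (≤⇒shiftʳ≡0 {a} {b} a≤b)) λ ()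

-- Iteration of an improving step

iter : (ℕ → ℕ) → ℕ → ℕ → ℕ
iter s q zero    = q
iter s q (suc n) = s (iter s q n)

brec≡iter : ∀ s q y → brec (λ _ → s) q y ≡ iter s q ∥ y ∥
brec≡iter s q = half-induction _ refl λ y ih →
  trans (brec-suc (λ _ → s) q y) (trans (cong s ih) (cong (iter s q) (sym (∥suc∥ y))))

-- The values grow at least geometrically, so r steps reach a value v ≥ 2 ^ r
-- and v further steps would visit more than 2 ^ r distinct arguments.
module _ (s v : ℕ → ℕ) (Final : ℕ → Set) (r : ℕ)
         (improve : ∀ q → (Final q × s q ≡ q) ⊎ (∥ s q ∥ ≤ r × 2 * v q < v (s q))) where

  private
    final-stays : ∀ {q} n → Final q → s q ≡ q → iter s q n ≡ q
    final-stays zero    _ _  = refl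
    final-stays (suc n) p eq = trans (cong s (final-stays n p eq)) eq

    Grows : ℕ → ℕ → Set
    Grows q n = ∀ i → i < n → ∥ s (iter s q i) ∥ ≤ r × 2 * v (iter s q i) < v (s (iter s q i))

    run : ∀ q n → (Final (iter s q n) × s (iter s q n) ≡ iter s q n) ⊎ Grows q n
    run q zero    = inj₂ λ _ ()
    run q (suc n) with run q n
    ... | inj₁ (p , eq) = inj₁ (subst (λ z → Final z × s z ≡ z) (sym eq) (p , eq))
    ... | inj₂ g with improve (iter s q n)
    ...   | inj₁ (p , eq) = inj₁ (subst (λ z → Final z × s z ≡ z) (sym eq) (p , eq))
    ...   | inj₂ g′ = inj₂ λ i i<1+n → case-last i (m≤n⇒m<n∨m≡n (s≤s⁻¹ i<1+n))
      where
      case-last : ∀ i → i < n ⊎ i ≡ n → ∥ s (iter s q i) ∥ ≤ r × 2 * v (iter s q i) < v (s (iter s q i))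
      case-last i (inj₁ i<n)  = g i i<n
      case-last i (inj₂ refl) = g′

    -- The successor admits a start at value 0: from `2 * v < v′` follows `2 * suc v ≤ suc v′`, so
    -- the successor of the value at least doubles at every step.
    geometric : ∀ q n → Grows q n → ∀ i → i ≤ n → 2 ^ i ≤ suc (v (iter s q i))
    geometric q n g zero    _   = s≤s z≤n
    geometric q n g (suc i) i<n = begin
      2 * 2 ^ i                      ≤⟨ *-monoʳ-≤ 2 (geometric q n g i (<⇒≤ i<n)) ⟩
      2 * suc (v (iter s q i))       ≡⟨ *-suc 2 _ ⟩
      2 + 2 * v (iter s q i)         ≤⟨ s≤s (proj₂ (g i i<n)) ⟩
      suc (v (s (iter s q i)))       ∎
      where open ≤-Reasoning

    v-increasing : ∀ q n → Grows q n → ∀ i j → i < j → j ≤ n → v (iter s q i) < v (iter s q j)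
    v-increasing q n g i (suc j) (s≤s i≤j) j<n with m≤n⇒m<n∨m≡n i≤j
    ... | inj₁ i<j  = <-trans (v-increasing q n g i j i<j (<⇒≤ j<n)) (step j j<n)
      where
      step : ∀ j → j < n → v (iter s q j) < v (iter s q (suc j))
      step j j<n = ≤-<-trans (m≤m+n _ _) (proj₂ (g j j<n))
    ... | inj₂ refl = ≤-<-trans (m≤m+n _ _) (proj₂ (g j j<n))

    -- Only results of steps are known to have length at most `r`, so the iterates 1 to `n` are
    -- counted, without the starting point. They are distinct because `v` increases along them.
    few : ∀ q n → Grows q n → n ≤ 2 ^ r
    few q n g = ≮⇒≥ λ 2^r<n →
      let point i = fromℕ< (∥∥≤⇒<2^ (proj₁ (g (toℕ i) (toℕ<n i))))
          i , j , i<j , eq = pigeonhole 2^r<n point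
          same = trans (sym (toℕ-fromℕ< _)) (trans (cong toℕ eq) (toℕ-fromℕ< _))
      in <-irrefl (cong v same)
           (v-increasing q n g (suc (toℕ i)) (suc (toℕ j)) (s≤s i<j) (toℕ<n j))

  iterate-twice : ∀ q n → 2 + r ≤ n → let q₁ = iter s q n in Final (iter s q₁ (v q₁))
  iterate-twice q n 2+r≤n with run q n
  ... | inj₁ (p , eq) = subst Final (sym (final-stays (v (iter s q n)) p eq)) p
  ... | inj₂ g with run (iter s q n) (v (iter s q n))
  ...   | inj₁ (p , _) = p
  -- The two steps beyond `r` absorb the successor in `geometric` and push the value strictly above
  -- `2 ^ r`, against `few`.
  ...   | inj₂ g′ = contradiction (few _ _ g′) (<⇒≱ (s≤s⁻¹ (begin
    2 + 2 ^ r                        ≤⟨ +-monoˡ-≤ (2 ^ r) (m≤m*n 2 (2 ^ r) {{m^n≢0 2 r}}) ⟩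
    2 * 2 ^ r + 2 ^ r                ≤⟨ +-monoʳ-≤ (2 * 2 ^ r) (m≤m+n (2 ^ r) _) ⟩
    2 * 2 ^ r + 2 * 2 ^ r            ≡⟨ cong (2 * 2 ^ r +_) (+-identityʳ (2 * 2 ^ r)) ⟨
    2 ^ (2 + r)                      ≤⟨ ^-monoʳ-≤ 2 2+r≤n ⟩
    2 ^ n                            ≤⟨ geometric q n g n ≤-refl ⟩
    suc (v (iter s q n))             ∎)))
    where open ≤-Reasoning

-- A type 2 functional with a single function argument

Fn : ℕ → Set
Fn n = (ℕ → ℕ) → Vec ℕ n → ℕ

-- A record rather than a synonym, so that unification recovers `F` from `BF F`.
record BF {n} (F : Fn n) : Set where
  constructor bf
  field unbf : BFF {1} {n} (λ fs → F (head fs))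
open BF

record BFs {m n} (T : (ℕ → ℕ) → Vec ℕ m → Vec ℕ n) : Set where
  constructor bfs
  field component : ∀ i → BF (λ f v → lookup (T f v) i)

-- Splitting and joining argument lists.

take-++ : ∀ {A : Set} (xs : Vec A m) (ys : Vec A n) → take m (xs ++ ys) ≡ xs
take-++ []       ys = refl
take-++ (x ∷ xs) ys = cong (x ∷_) (take-++ xs ys)

drop-++ : ∀ {A : Set} (xs : Vec A m) (ys : Vec A n) → drop m (xs ++ ys) ≡ ys
drop-++ []       ys = refl
drop-++ (x ∷ xs) ys = drop-++ xs ys

rejoin : ∀ (v : Vec ℕ (l + 1)) → take l v ++ head (drop l v) ∷ [] ≡ v
rejoin {l} v with drop l v | take++drop≡id l v
... | _ ∷ [] | eq = eq

lookup-take : ∀ (xs : Vec ℕ (m + n)) i → lookup (take m xs) i ≡ lookup xs (i ↑ˡ n)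
lookup-take {suc m} (x ∷ xs) zero    = refl
lookup-take {suc m} (x ∷ xs) (suc i) = lookup-take xs i

lookup-drop : ∀ (xs : Vec ℕ (m + n)) i → lookup (drop m xs) i ≡ lookup xs (m ↑ʳ i)
lookup-drop {zero}  xs       i = refl
lookup-drop {suc m} (x ∷ xs) i = lookup-drop {m} xs i

-- Substitution and projections.

BF-resp : {F G : Fn n} → (∀ f v → F f v ≡ G f v) → BF F → BF G
BF-resp eq (bf F) = bf (resp (λ fs → eq (head fs)) F)

-- Expanding `proj i` by a function alone would leave `n + 0` number arguments. So the unary
-- projection is expanded to all places, and a transposition brings the chosen variable to the
-- front.
var-BF : ∀ (i : Fin n) → BF (λ _ v → lookup v i)
var-BF {suc n} i = bf (resp (λ { fs (x ∷ xs) → lookup∘tabulate (λ j → lookup (x ∷ xs) (π Perm.⟨$⟩ʳ j)) zero })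
  (reorder Perm.id π (expand 1 n (proj {1} zero))))
  where π = Perm.transpose zero i

lookup-tail : ∀ (v : Vec ℕ (suc n)) i → lookup (tail v) i ≡ lookup v (suc i)
lookup-tail (_ ∷ _) _ = refl

lookup-head : ∀ (v : Vec ℕ (suc n)) → head v ≡ lookup v zero
lookup-head (_ ∷ _) = refl

id-BFs : BFs {n} (λ _ v → v)
id-BFs = bfs var-BF

tail-BFs : {T : (ℕ → ℕ) → Vec ℕ m → Vec ℕ (suc n)} → BFs T → BFs (λ f v → tail (T f v))
tail-BFs {T = T} (bfs t) = bfs λ i → BF-resp (λ f v → sym (lookup-tail (T f v) i)) (t (suc i))

infixr 5 _∷ᵇ_ _++ᵇ_

_∷ᵇ_ : {F : Fn m} {T : (ℕ → ℕ) → Vec ℕ m → Vec ℕ n} → BF F → BFs T → BFs (λ f v → F f v ∷ T f v)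
F ∷ᵇ bfs T = bfs λ { zero → F ; (suc i) → T i }

[]ᵇ : BFs {m} (λ _ _ → [])
[]ᵇ = bfs λ ()

_++ᵇ_ : {T : (ℕ → ℕ) → Vec ℕ k → Vec ℕ m} {T′ : (ℕ → ℕ) → Vec ℕ k → Vec ℕ n} →
        BFs T → BFs T′ → BFs (λ f v → T f v ++ T′ f v)
_++ᵇ_ {m = m} {n} {T} {T′} (bfs t) (bfs t′) = bfs component-++
  where
  component-++ : ∀ i → BF (λ f v → lookup (T f v ++ T′ f v) i)
  component-++ i with splitAt m i in eq
  ... | inj₁ j = BF-resp (λ f v → trans (sym (lookup-++ˡ (T f v) (T′ f v) j))
                                    (cong (lookup (T f v ++ T′ f v)) (splitAt⁻¹-↑ˡ eq))) (t j)
  ... | inj₂ j = BF-resp (λ f v → trans (sym (lookup-++ʳ (T f v) (T′ f v) j))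
                                    (cong (lookup (T f v ++ T′ f v)) (splitAt⁻¹-↑ʳ {m} eq))) (t′ j)

-- `comp` passes the original arguments on behind the new ones; expanding `H` by `n` dummy places
-- lets it ignore them.
sub : {H : Fn m} {T : (ℕ → ℕ) → Vec ℕ n → Vec ℕ m} → BF H → BFs T → BF (λ f v → H f (T f v))
sub {m} {n} {H} {T} (bf h) (bfs t) = bf (resp
  (λ { (f ∷ []) v → cong (H f) (trans (take-++ (tabulate (lookup (T f v))) v) (tabulate∘lookup (T f v))) })
  (comp (expand 0 n h) (λ i → unbf (t i))))

sub-BFs : {T′ : (ℕ → ℕ) → Vec ℕ m → Vec ℕ k} {T : (ℕ → ℕ) → Vec ℕ n → Vec ℕ m} →
          BFs T′ → BFs T → BFs (λ f v → T′ f (T f v))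
sub-BFs (bfs t′) t = bfs λ i → sub (t′ i) t

head-BF : {T : (ℕ → ℕ) → Vec ℕ m → Vec ℕ (suc n)} → BFs T → BF (λ f v → head (T f v))
head-BF {T = T} (bfs t) = BF-resp (λ f v → sym (lookup-head (T f v))) (t zero)

take-BFs : ∀ m → BFs {m + n} (λ _ v → take m v)
take-BFs m = bfs λ i → BF-resp (λ _ v → sym (lookup-take {m} v i)) (var-BF (i ↑ˡ _))

drop-BFs : ∀ m → BFs {m + n} (λ _ v → drop m v)
drop-BFs m = bfs λ i → BF-resp (λ _ v → sym (lookup-drop {m} v i)) (var-BF (m ↑ʳ i))

module _ {E : Fn n} (e : BF E) where

  -- There is no constant of rank (1 , 0), hence the argument e.
  zero-BF : BF {n} (λ _ _ → 0)
  zero-BF = sub {H = λ _ _ → 0} (bf (expand 1 0 o)) (e ∷ᵇ []ᵇ)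

  double-BF : BF (λ f v → 2 * E f v)
  double-BF = sub {H = λ _ v → 2 * head v} (bf (resp (λ { _ (_ ∷ []) → refl }) (expand 1 0 s₀))) (e ∷ᵇ []ᵇ)

  double+1-BF : BF (λ f v → 1 + 2 * E f v)
  double+1-BF = sub {H = λ _ v → 1 + 2 * head v}
    (bf (resp (λ { _ (x ∷ []) → +-comm (2 * x) 1 }) (expand 1 0 s₁))) (e ∷ᵇ []ᵇ)

  apply-BF : BF (λ f v → f (E f v))
  apply-BF = sub {H = λ f v → f (head v)} (bf (resp (λ { (_ ∷ []) (_ ∷ []) → refl }) ap)) (e ∷ᵇ []ᵇ)

-- Smash as a bound on lengths.

infixl 7 _⊠_

-- Abstract because the unfolded powers of two make conversion checking explode.
abstract
  _⊠_ : ℕ → ℕ → ℕ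
  a ⊠ b = 2 ^ (∥ 1 + 2 * a ∥ * ∥ 1 + 2 * b ∥)

  -- The digit 1 appended to each argument keeps both factors positive, so this single operation
  -- bounds maxima, sums and products of lengths.
  ∥⊠∥ : ∀ a b → ∥ a ⊠ b ∥ ≡ suc (suc ∥ a ∥ * suc ∥ b ∥)
  ∥⊠∥ a b = trans (∥2^∥ (∥ 1 + 2 * a ∥ * ∥ 1 + 2 * b ∥)) (cong suc (cong₂ _*_ (∥1+2*∥ a) (∥1+2*∥ b)))

  ⊠-BF : {A B : Fn n} → BF A → BF B → BF (λ f v → A f v ⊠ B f v)
  ⊠-BF a b = sub {H = λ _ → smash []} (bf (resp {G = λ _ → smash []} (λ { _ (_ ∷ _ ∷ []) → refl }) (expand 1 0 #)))
    (double+1-BF a ∷ᵇ double+1-BF b ∷ᵇ []ᵇ)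

∥⊠∥>ˡ : ∀ a b → ∥ a ∥ < ∥ a ⊠ b ∥
∥⊠∥>ˡ a b rewrite ∥⊠∥ a b = s≤s (≤-trans (n≤1+n _) (m≤m*n (suc ∥ a ∥) (suc ∥ b ∥)))

∥⊠∥≥+ : ∀ a b → ∥ a ∥ + ∥ b ∥ ≤ ∥ a ⊠ b ∥
∥⊠∥≥+ a b rewrite ∥⊠∥ a b = begin
  ∥ a ∥ + ∥ b ∥               ≡⟨ +-comm ∥ a ∥ ∥ b ∥ ⟩
  ∥ b ∥ + ∥ a ∥               ≤⟨ +-monoʳ-≤ ∥ b ∥ (m≤m*n ∥ a ∥ (suc ∥ b ∥)) ⟩
  ∥ b ∥ + ∥ a ∥ * suc ∥ b ∥   ≤⟨ m≤n+m _ 2 ⟩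
  suc (suc ∥ a ∥ * suc ∥ b ∥) ∎
  where open ≤-Reasoning

∥⊠∥≥ˡ : ∀ a b → ∥ a ∥ ≤ ∥ a ⊠ b ∥
∥⊠∥≥ˡ a b = ≤-trans (m≤m+n _ _) (∥⊠∥≥+ a b)

∥⊠∥≥ʳ : ∀ a b → ∥ b ∥ ≤ ∥ a ⊠ b ∥
∥⊠∥≥ʳ a b = ≤-trans (m≤n+m _ ∥ a ∥) (∥⊠∥≥+ a b)

-- Limited recursion on notation and its first uses.

module _ {C G : Fn n} {S : Fn (2 + n)} {K : Fn (1 + n)} where

  -- `limrec` recurses on the last argument and gives its two step functions the half; `brec`
  -- recurses on the first and gives its step the whole number. Hence arguments are rotated, and
  -- each step function first restores the number from the half and its digit.
  brec-BF : BF C → BF G → BF S → BF K →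
    (∀ f v y → ∥ brec (λ y r → S f (y ∷ r ∷ v)) (G f v) y ∥ ≤ ∥ K f (y ∷ v) ∥) →
    BF (λ f v → brec (λ y r → S f (y ∷ r ∷ v)) (G f v) (C f v))
  brec-BF c g s κ bound = BF-resp (λ f v → cong (R f) (rotate-++ v (C f v))) (sub R-BF (id-BFs ++ᵇ c ∷ᵇ []ᵇ))
    where
    rotate : ∀ {m} → Vec ℕ (n + m) → Vec ℕ (m + n)
    rotate v = drop n v ++ take n v

    rotate-++ : ∀ (v : Vec ℕ n) y → rotate (v ++ y ∷ []) ≡ y ∷ v
    rotate-++ v y rewrite take-++ v (y ∷ []) | drop-++ v (y ∷ []) = refl

    R : (ℕ → ℕ) → Vec ℕ (1 + n) → ℕ
    R f v = brec (λ y r → S f (y ∷ r ∷ tail v)) (G f (tail v)) (head v)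

    step : (ℕ → ℕ) → Fn (n + 2)
    step d f v = S f (d (head (rotate v)) ∷ tail (rotate {2} v))

    rotate-BFs : ∀ {m} → BFs {n + m} (λ _ → rotate)
    rotate-BFs = drop-BFs n ++ᵇ take-BFs n

    step-++ : ∀ d f v y r → S f (d y ∷ r ∷ v) ≡ step d f (v ++ y ∷ r ∷ [])
    step-++ d f v y r rewrite take-++ v (y ∷ r ∷ []) | drop-++ v (y ∷ r ∷ []) = refl

    -- Here `d` appends a digit. The equation with `pred` says that `d y` is positive, so that
    -- `brec-suc` applies.
    R-step : ∀ d f v y → suc (pred (d y)) ≡ d y → ⌊ d y /2⌋ ≡ y →
             R f (rotate (v ++ d y ∷ [])) ≡ step d f (v ++ y ∷ R f (rotate (v ++ y ∷ [])) ∷ [])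
    R-step d f v y pos half
      rewrite rotate-++ v (d y) | rotate-++ v y | sym (step-++ d f v y (R f (y ∷ v))) =
      trans (cong (λ z → R f (z ∷ v)) (sym pos))
        (trans (brec-suc (λ y r → S f (y ∷ r ∷ v)) (G f v) (pred (d y)))
          (cong₂ (λ z h → S f (z ∷ R f (h ∷ v) ∷ v)) pos (trans (cong ⌊_/2⌋ pos) half)))

    R-BF : BF (λ f v → R f (rotate v))
    R-BF = bf (limrec
      (unbf g)
      (unbf (sub s (double-BF (head-BF rotate-BFs) ∷ᵇ tail-BFs (rotate-BFs {2}))))
      (unbf (sub s (double+1-BF (head-BF rotate-BFs) ∷ᵇ tail-BFs (rotate-BFs {2}))))
      (unbf (sub κ (rotate-BFs {1})))
      (λ { (f ∷ []) v → cong (R f) (rotate-++ v 0) })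
      (λ { (f ∷ []) v (suc y) _ → R-step (2 *_) f v (suc y) refl (half-2* (suc y)) })
      (λ { (f ∷ []) v y → trans (cong (λ z → R f (rotate (v ++ z ∷ []))) (+-comm (2 * y) 1))
                            (R-step (λ y → 1 + 2 * y) f v y refl (half-1+2* y)) })
      (λ { (f ∷ []) v y → subst (λ w → ∥ R f w ∥ ≤ ∥ K f w ∥) (sym (rotate-++ v y)) (bound f v y) }))

module _ {E : Fn n} (e : BF E) where

  -- The recursion variable is the second argument: limrec needs G to be
  -- basic feasible, hence of positive rank.
  private
    bits : ∀ (d : ℕ → ℕ) {H₁ H₂ : Fn 3} → BF H₁ → BF H₂ → d 0 ≡ 0 →
           (∀ f x y → d (2 * suc y) ≡ H₁ f (x ∷ suc y ∷ d (suc y) ∷ [])) →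
           (∀ f x y → d (1 + 2 * y) ≡ H₂ f (x ∷ y ∷ d y ∷ [])) →
           (∀ y → ∥ d y ∥ ≤ ∥ 1 + 2 * y ∥) →
           BF (λ f v → d (E f v))
    bits d h₁ h₂ eq₀ eq₁ eq₂ bound = sub {H = λ _ v → d (lookup v (suc zero))} (bf (limrec {l = 1}
      (unbf (zero-BF (var-BF zero))) (unbf h₁) (unbf h₂) (unbf (double+1-BF (var-BF (suc zero))))
      (λ { _ (_ ∷ []) → eq₀ })
      (λ { (f ∷ []) (x ∷ []) (suc y) _ → eq₁ f x y })
      (λ { (f ∷ []) (x ∷ []) y → trans (cong d (+-comm (2 * y) 1)) (eq₂ f x y) })
      (λ { _ (_ ∷ []) y → bound y }))) (e ∷ᵇ e ∷ᵇ []ᵇ)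

  half-BF : BF (λ f v → ⌊ E f v /2⌋)
  half-BF = bits ⌊_/2⌋ (var-BF (suc zero)) (var-BF (suc zero)) refl
    (λ _ _ y → half-2* (suc y)) (λ _ _ → half-1+2*)
    (λ y → ∥∥-mono {⌊ y /2⌋} {1 + 2 * y} (≤-trans (⌊n/2⌋≤n y) (≤-trans (m≤m+n y _) (n≤1+n _))))

  odd-BF : BF (λ f v → odd (E f v))
  odd-BF = bits odd (zero-BF (var-BF zero)) (double+1-BF (zero-BF (var-BF zero))) refl
    (λ _ _ y → odd-2* (suc y)) (λ _ _ → odd-1+2*)
    (λ y → ∥∥-mono {odd y} {1 + 2 * y} (≤-trans (odd≤1 y) (s≤s z≤n)))
    where
    odd≤1 : ∀ y → odd y ≤ 1
    odd≤1 zero          = z≤n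
    odd≤1 (suc zero)    = ≤-refl
    odd≤1 (suc (suc y)) = odd≤1 y

module _ {A B : Fn n} (a : BF A) (b : BF B) where

  shiftʳ-BF : BF (λ f v → shiftʳ (A f v) (B f v))
  shiftʳ-BF = brec-BF b a (half-BF (var-BF (suc zero))) (sub a (tail-BFs id-BFs))
    λ f v y → subst (_≤ ∥ A f v ∥) (sym (∥shiftʳ∥ (A f v) y)) (m∸n≤m _ ∥ y ∥)

  -- Case distinction is a recursion on notation with a constant step.
  ite-BF : {C : Fn n} → BF C → BF (λ f v → ite (C f v) (A f v) (B f v))
  ite-BF {C} c = BF-resp (λ f v → brec-ite (C f v))
    (brec-BF c a (sub b (tail-BFs (tail-BFs id-BFs)))
      (⊠-BF (sub a (tail-BFs id-BFs)) (sub b (tail-BFs id-BFs)))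
      λ f v y → subst (λ z → ∥ z ∥ ≤ _) (sym (brec-ite y)) (∥ite∥ y))
    where
    brec-ite : ∀ {x z} y → brec (λ _ _ → z) x y ≡ ite y x z
    brec-ite zero    = refl
    brec-ite (suc y) = refl

    ∥ite∥ : ∀ {x z} y → ∥ ite y x z ∥ ≤ ∥ x ⊠ z ∥
    ∥ite∥ {x} {z} zero    = ∥⊠∥≥ˡ x z
    ∥ite∥ {x} {z} (suc y) = ∥⊠∥≥ʳ x z

sub₂ : ∀ {W : (ℕ → ℕ) → Vec ℕ m → Vec ℕ n → ℕ}
       {S : (ℕ → ℕ) → Vec ℕ k → Vec ℕ m} {T : (ℕ → ℕ) → Vec ℕ k → Vec ℕ n} →
       BF (λ f v → W f (take m v) (drop m v)) → BFs S → BFs T →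
       BF (λ f v → W f (S f v) (T f v))
sub₂ {W = W} {S} {T} w s t = BF-resp
  (λ f v → cong₂ (W f) (take-++ (S f v) (T f v)) (drop-++ (S f v) (T f v)))
  (sub w (s ++ᵇ t))

tabulate-BFs : {G : Fin m → Fn n} → (∀ i → BF (G i)) → BFs (λ f v → tabulate (λ i → G i f v))
tabulate-BFs {G = G} g = bfs λ i → BF-resp (λ f v → sym (lookup∘tabulate (λ i → G i f v) i)) (g i)

permute-BFs : (ρ : Perm.Permutation′ n) → BFs (λ _ v → permute ρ v)
permute-BFs ρ = tabulate-BFs (λ i → var-BF (ρ Perm.⟨$⟩ʳ i))

take-replicate : ∀ {A : Set} k {k′} (f : A) → take k (replicate (k + k′) f) ≡ replicate k f
take-replicate zero    f = refl
take-replicate (suc k) f = cong (f ∷_) (take-replicate k f)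

permute-replicate : ∀ {A : Set} (π : Perm.Permutation′ k) (f : A) → permute π (replicate k f) ≡ replicate k f
permute-replicate {k} π f = trans
  (tabulate-cong λ i → trans (lookup-replicate (π Perm.⟨$⟩ʳ i) f) (sym (lookup-replicate i f)))
  (tabulate∘lookup (replicate k f))

even-or-odd : ∀ y → (odd y ≡ 0 × 2 * ⌊ y /2⌋ ≡ y) ⊎ (odd y ≡ 1 × 1 + 2 * ⌊ y /2⌋ ≡ y)
even-or-odd zero       = inj₁ (refl , refl)
even-or-odd (suc zero) = inj₂ (refl , refl)
even-or-odd (suc (suc y)) rewrite +-suc ⌊ y /2⌋ (⌊ y /2⌋ + 0) with even-or-odd y
... | inj₁ (p , eq) = inj₁ (p , cong 2+ eq)
... | inj₂ (p , eq) = inj₂ (p , cong 2+ eq)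

-- Searching a computation for bad queries

module Trace {P : ℕ} (bad : Fn (1 + P)) (U : Fn P) (bad-BF : BF bad) (U-BF : BF U)
             (bad-bounded : ∀ f ps q → bad f (q ∷ ps) ≢ 0 → ∥ q ∥ ≤ ∥ U f ps ∥) where

  Agree : (ℕ → ℕ) → Vec ℕ P → (ℕ → ℕ) → Set
  Agree f ps g = ∀ q → bad f (q ∷ ps) ≡ 0 → g q ≡ f q

  -- A search result w is 0 (nothing found) or 1 + 2 * q (q is a bad query).
  Unless : (ℕ → ℕ) → Vec ℕ P → ℕ → Set → Set
  Unless f ps w X = (w ≡ 0 × X) ⊎ (∃ λ q → w ≡ 1 + 2 * q × bad f (q ∷ ps) ≢ 0)

  -- The induction on derivations is carried out for arbitrary rank, so all function arguments are
  -- taken to be copies of one function.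
  Insensitive : (ℕ → ℕ) → Vec ℕ P → Functional k l → Vec ℕ l → Set
  Insensitive {k} f ps F xs = ∀ g → Agree f ps g → F (replicate k g) xs ≡ F (replicate k f) xs

  map-Unless : ∀ {f ps w X Y} → (X → Y) → Unless f ps w X → Unless f ps w Y
  map-Unless h (inj₁ (eq , x)) = inj₁ (eq , h x)
  map-Unless h (inj₂ found)    = inj₂ found

  _orElse_ : ℕ → ℕ → ℕ
  w orElse w′ = ite w w′ w

  orElse-Unless : ∀ {f ps w w′ X Y} → Unless f ps w X → (X → Unless f ps w′ Y) → Unless f ps (w orElse w′) Y
  orElse-Unless (inj₁ (refl , x))     h = h x
  orElse-Unless (inj₂ (q , refl , b)) h = inj₂ (q , refl , b)

  -- This is what makes the search through a recursion a limited recursion itself.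
  Unless-bounded : ∀ {f ps w X} → Unless f ps w X → ∥ w ∥ ≤ ∥ 1 + 2 * U f ps ∥
  Unless-bounded (inj₁ (refl , _)) = z≤n
  Unless-bounded {f} {ps} (inj₂ (q , refl , b)) =
    subst₂ _≤_ (sym (∥1+2*∥ q)) (sym (∥1+2*∥ (U f ps))) (s≤s (bad-bounded f ps q b))

  -- The induction hypothesis on derivations. `trace` looks for a bad query in the computation of
  -- `F`; when it finds none, changing `f` at bad queries cannot affect the value. `diag-BF` is
  -- carried along because searches have to evaluate subcomputations.
  record Traced (F : Functional k l) : Set where
    field
      diag-BF  : BF (λ f → F (replicate k f))
      trace    : (ℕ → ℕ) → Vec ℕ P → Vec ℕ l → ℕ
      trace-BF : BF (λ f v → trace f (take P v) (drop P v))
      traces   : ∀ f ps xs → Unless f ps (trace f ps xs) (Insensitive f ps F xs)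
  open Traced

  nothing-BF : BF {P + l} (λ _ _ → 0)
  nothing-BF = zero-BF (sub U-BF (take-BFs P))

  oblivious : {F : Functional k l} → BF (λ f → F (replicate k f)) →
              (∀ f g xs → F (replicate k g) xs ≡ F (replicate k f) xs) → Traced F
  oblivious d eq = record
    { diag-BF = d ; trace = λ _ _ _ → 0 ; trace-BF = nothing-BF
    ; traces = λ f ps xs → inj₁ (refl , λ g _ → eq f g xs) }

  trace-all : {G : Fin m → Functional k l} → (∀ i → Traced (G i)) →
    ∃ λ (W : (ℕ → ℕ) → Vec ℕ P → Vec ℕ l → ℕ) → BF (λ f v → W f (take P v) (drop P v)) ×
      (∀ f ps xs → Unless f ps (W f ps xs) (∀ i → Insensitive f ps (G i) xs))
  trace-all {zero} t = (λ _ _ _ → 0) , nothing-BF , λ f ps xs → inj₁ (refl , λ ())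
  trace-all {suc m} {G = G} t =
    let W , W-BF , W-traces = trace-all {G = G ∘ suc} (t ∘ suc) in
    (λ f ps xs → trace (t zero) f ps xs orElse W f ps xs) ,
    ite-BF W-BF (trace-BF (t zero)) (trace-BF (t zero)) ,
    λ f ps xs → orElse-Unless (traces (t zero) f ps xs)
      λ h → map-Unless (λ { hs zero → h ; hs (suc i) → hs i }) (W-traces f ps xs)

  traced-resp : {F G : Functional k l} → (∀ fs xs → F fs xs ≡ G fs xs) → Traced F → Traced G
  traced-resp eq t = record
    { diag-BF  = BF-resp (λ f → eq _) (diag-BF t)
    ; trace    = trace t
    ; trace-BF = trace-BF t
    ; traces   = λ f ps xs → map-Unless
        (λ same g agree → trans (sym (eq _ xs)) (trans (same g agree) (eq _ xs))) (traces t f ps xs) }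

  -- If the searches through the inner functionals find nothing, their values are the same for `f`
  -- and the modified function, so it is enough to search the outer one at the values for `f`.
  traced-comp : {H : Functional k (m + l)} {G : Fin m → Functional k l} → Traced H → (∀ i → Traced (G i)) →
                Traced (λ fs xs → H fs (tabulate (λ i → G i fs xs) ++ xs))
  traced-comp {k} {m} {l} {H} {G} h g = record
    { diag-BF  = sub (diag-BF h) (tabulate-BFs (diag-BF ∘ g) ++ᵇ id-BFs)
    ; trace    = λ f ps xs → W f ps xs orElse trace h f ps (args f xs)
    ; trace-BF = ite-BF (sub₂ {W = trace h} (trace-BF h) (take-BFs P)
        (sub-BFs {T′ = args} (tabulate-BFs (diag-BF ∘ g) ++ᵇ id-BFs) (drop-BFs P))) W-BF W-BF
    ; traces   = λ f ps xs → orElse-Unless (W-traces f ps xs) λ same →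
        map-Unless (λ same′ g′ agree → trans
          (cong (λ ys → H (replicate k g′) (ys ++ xs)) (tabulate-cong λ i → same i g′ agree))
          (same′ g′ agree))
        (traces h f ps (args f xs)) }
    where
    args : (ℕ → ℕ) → Vec ℕ l → Vec ℕ (m + l)
    args f xs = tabulate (λ i → G i (replicate k f) xs) ++ xs
    W = proj₁ (trace-all g)
    W-BF = proj₁ (proj₂ (trace-all g))
    W-traces = proj₂ (proj₂ (trace-all g))

  traced-expand : ∀ k′ l′ {G : Functional k l} → Traced G →
                  Traced {k + k′} {l + l′} (λ fs xs → G (take k fs) (take l xs))
  traced-expand {k} {l} k′ l′ {G} g = record
    { diag-BF  = BF-resp (λ f xs → cong (λ fs → G fs (take l xs)) (sym (take-replicate k f)))
                   (sub (diag-BF g) (take-BFs l))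
    ; trace    = λ f ps xs → trace g f ps (take l xs)
    ; trace-BF = sub₂ {W = trace g} (trace-BF g) (take-BFs P) (sub-BFs (take-BFs l) (drop-BFs P))
    ; traces   = λ f ps xs → map-Unless
        (λ same g′ agree → subst₂ (λ gs fs → G gs (take l xs) ≡ G fs (take l xs))
          (sym (take-replicate k g′)) (sym (take-replicate k f)) (same g′ agree))
        (traces g f ps (take l xs)) }

  traced-reorder : ∀ {G : Functional k l} (π : Perm.Permutation′ k) (ρ : Perm.Permutation′ l) → Traced G →
                   Traced (λ fs xs → G (permute π fs) (permute ρ xs))
  traced-reorder {k} {l} {G} π ρ g = record
    { diag-BF  = BF-resp (λ f xs → cong (λ fs → G fs (permute ρ xs)) (sym (permute-replicate π f)))
                   (sub (diag-BF g) (permute-BFs ρ))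
    ; trace    = λ f ps xs → trace g f ps (permute ρ xs)
    ; trace-BF = sub₂ {W = trace g} (trace-BF g) (take-BFs P) (sub-BFs (permute-BFs ρ) (drop-BFs P))
    ; traces   = λ f ps xs → map-Unless
        (λ same g′ agree → subst₂ (λ gs fs → G gs (permute ρ xs) ≡ G fs (permute ρ xs))
          (sym (permute-replicate π g′)) (sym (permute-replicate π f)) (same g′ agree))
        (traces g f ps (permute ρ xs)) }

  -- The only rule that queries the function: its argument is the query to be tested.
  traced-ap : Traced Ap
  traced-ap = record
    { diag-BF  = BF-resp (λ { _ (_ ∷ []) → refl }) (apply-BF (head-BF id-BFs))
    ; trace    = λ f ps xs → ite (bad f (head xs ∷ ps)) 0 (1 + 2 * head xs)
    ; trace-BF = ite-BF nothing-BF (double+1-BF x) (sub bad-BF (x ∷ᵇ take-BFs P))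
    ; traces   = λ { f ps (x ∷ []) → query f ps x } }
    where
    x = head-BF (drop-BFs P)
    query : ∀ f ps x → Unless f ps (ite (bad f (x ∷ ps)) 0 (1 + 2 * x)) (Insensitive f ps Ap (x ∷ []))
    query f ps x with bad f (x ∷ ps) in eq
    ... | zero  = inj₁ (refl , λ g agree → agree x eq)
    ... | suc _ = inj₂ (x , refl , λ eq′ → contradiction (trans (sym eq) eq′) λ ())

  module _ {G : Functional k l} {H₁ H₂ : Functional k (l + 2)} {K F : Functional k (l + 1)}
           (g : Traced G) (h₁ : Traced H₁) (h₂ : Traced H₂) (κ : Traced K)
           (F-zero : ∀ fs xs → F fs (xs ++ 0 ∷ []) ≡ G fs xs)
           (F-even : ∀ fs xs y → y > 0 →
             F fs (xs ++ 2 * y ∷ []) ≡ H₁ fs (xs ++ y ∷ F fs (xs ++ y ∷ []) ∷ []))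
           (F-odd : ∀ fs xs y →
             F fs (xs ++ 2 * y + 1 ∷ []) ≡ H₂ fs (xs ++ y ∷ F fs (xs ++ y ∷ []) ∷ []))
           (F-bounded : ∀ fs xs y → ∥ F fs (xs ++ y ∷ []) ∥ ≤ ∥ K fs (xs ++ y ∷ []) ∥) where

    private
      d : BF (λ f → F (replicate k f))
      d = bf (limrec (unbf (diag-BF g)) (unbf (diag-BF h₁)) (unbf (diag-BF h₂)) (unbf (diag-BF κ))
        (λ fs → F-zero _) (λ fs → F-even _) (λ fs → F-odd _) (λ fs → F-bounded _))

      args : (ℕ → ℕ) → Vec ℕ l → ℕ → Vec ℕ (l + 2)
      args f xs y = xs ++ ⌊ y /2⌋ ∷ F (replicate k f) (xs ++ ⌊ y /2⌋ ∷ []) ∷ []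

      -- The recursion carries only the search result, keeping the first bad query found; the
      -- previous value of `F` is evaluated afresh in `args`.
      step : (ℕ → ℕ) → Vec ℕ P → Vec ℕ l → ℕ → ℕ → ℕ
      step f ps xs y r =
        r orElse ite (odd y) (trace h₁ f ps (args f xs y)) (trace h₂ f ps (args f xs y))

      W : (ℕ → ℕ) → Vec ℕ P → Vec ℕ l → ℕ → ℕ
      W f ps xs = brec (step f ps xs) (trace g f ps xs)

      W-traces : ∀ f ps xs y → Unless f ps (W f ps xs y) (Insensitive f ps F (xs ++ y ∷ []))
      W-traces f ps xs = half-induction _
        (map-Unless (λ same g′ agree → trans (F-zero _ xs) (trans (same g′ agree) (sym (F-zero _ xs))))
          (traces g f ps xs))
        (λ y ih → subst (λ w → Unless f ps w (Insensitive f ps F (xs ++ suc y ∷ [])))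
          (sym (brec-suc (step f ps xs) (trace g f ps xs) y))
          (orElse-Unless ih (last-step (suc y) (s≤s z≤n))))
        where
        via : ∀ {H : Functional k (l + 2)} y →
              (∀ fs → F fs (xs ++ y ∷ []) ≡ H fs (xs ++ ⌊ y /2⌋ ∷ F fs (xs ++ ⌊ y /2⌋ ∷ []) ∷ [])) →
              Insensitive f ps F (xs ++ ⌊ y /2⌋ ∷ []) → Insensitive f ps H (args f xs y) →
              Insensitive f ps F (xs ++ y ∷ [])
        via {H} y eq same same′ g′ agree = begin
          F (replicate k g′) (xs ++ y ∷ [])            ≡⟨ eq (replicate k g′) ⟩
          H (replicate k g′) (xs ++ ⌊ y /2⌋ ∷ F (replicate k g′) (xs ++ ⌊ y /2⌋ ∷ []) ∷ [])
            ≡⟨ cong (λ r → H (replicate k g′) (xs ++ ⌊ y /2⌋ ∷ r ∷ [])) (same g′ agree) ⟩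
          H (replicate k g′) (args f xs y)             ≡⟨ same′ g′ agree ⟩
          H (replicate k f) (args f xs y)              ≡⟨ eq (replicate k f) ⟨
          F (replicate k f) (xs ++ y ∷ [])             ∎
          where open ≡-Reasoning

        last-step : ∀ y → y > 0 → Insensitive f ps F (xs ++ ⌊ y /2⌋ ∷ []) →
          Unless f ps (ite (odd y) (trace h₁ f ps (args f xs y)) (trace h₂ f ps (args f xs y)))
                      (Insensitive f ps F (xs ++ y ∷ []))
        last-step y y>0 same with odd y | even-or-odd y
        ... | _ | inj₁ (refl , eq) = map-Unless
          (via {H₁} y (λ fs → trans (cong (λ z → F fs (xs ++ z ∷ [])) (sym eq)) (F-even fs xs ⌊ y /2⌋ (half>0 y eq y>0))) same)
          (traces h₁ f ps (args f xs y))
          where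
          half>0 : ∀ y → 2 * ⌊ y /2⌋ ≡ y → y > 0 → ⌊ y /2⌋ > 0
          half>0 (suc (suc y)) _ _ = s≤s z≤n
        ... | _ | inj₂ (refl , eq) = map-Unless
          (via {H₂} y (λ fs → trans (cong (λ z → F fs (xs ++ z ∷ [])) (trans (sym eq) (+-comm 1 (2 * ⌊ y /2⌋)))) (F-odd fs xs ⌊ y /2⌋)) same)
          (traces h₂ f ps (args f xs y))

    traced-limrec : Traced F
    traced-limrec = record
      { diag-BF  = d
      ; trace    = λ f ps v → W f ps (take l v) (head (drop l v))
      ; trace-BF = brec-BF (head-BF (sub-BFs (drop-BFs l) (drop-BFs P)))
          (sub₂ {W = trace g} (trace-BF g) (take-BFs P) (sub-BFs (take-BFs l) (drop-BFs P)))
          step-BF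
          (double+1-BF (sub U-BF (sub-BFs (take-BFs P) (tail-BFs id-BFs))))
          (λ f v y → Unless-bounded (W-traces f (take P v) (take l (drop P v)) y))
      ; traces   = λ f ps v → subst (λ v′ → Unless f ps (W f ps (take l v) (head (drop l v))) (Insensitive f ps F v′))
          (rejoin v) (W-traces f ps (take l v) (head (drop l v))) }
      where
      step-BF : BF {2 + (P + (l + 1))} (λ f w → step f (take P (tail (tail w))) (take l (drop P (tail (tail w)))) (head w) (head (tail w)))
      step-BF = ite-BF
        (ite-BF (sub₂ {W = trace h₁} (trace-BF h₁) ps args-BFs) (sub₂ {W = trace h₂} (trace-BF h₂) ps args-BFs) (odd-BF (head-BF id-BFs)))
        r r
        where
        r   = head-BF (tail-BFs id-BFs)
        ctx = tail-BFs (tail-BFs id-BFs)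
        ps  = sub-BFs (take-BFs P) ctx
        xs  = sub-BFs (take-BFs l) (sub-BFs (drop-BFs P) ctx)
        h   = half-BF (head-BF id-BFs)
        args-BFs : BFs (λ f w → args f (take l (drop P (tail (tail w)))) (head w))
        args-BFs = xs ++ᵇ h ∷ᵇ sub d (xs ++ᵇ h ∷ᵇ []ᵇ) ∷ᵇ []ᵇ

  traced : {F : Functional k l} → BFF F → Traced F
  traced (resp eq G) = traced-resp eq (traced G)
  traced o        = oblivious (zero-BF (var-BF zero)) λ _ _ _ → refl
  traced s₀       = oblivious (double-BF (head-BF id-BFs)) λ _ _ _ → refl
  traced s₁       = oblivious (BF-resp (λ _ v → +-comm 1 (2 * head v)) (double+1-BF (head-BF id-BFs))) λ _ _ _ → refl
  traced (proj i) = oblivious (var-BF i) λ _ _ _ → refl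
  traced #        = oblivious (bf (resp (λ { _ (_ ∷ _ ∷ []) → refl }) (expand 1 0 #))) λ _ _ _ → refl
  traced ap       = traced-ap
  traced (comp H G) = traced-comp (traced H) (λ i → traced (G i))
  traced (expand k′ l′ G) = traced-expand k′ l′ (traced G)
  traced (reorder π ρ G) = traced-reorder π ρ (traced G)
  traced (limrec G H₁ H₂ K eq₀ eq₁ eq₂ bound) =
    traced-limrec (traced G) (traced H₁) (traced H₂) (traced K) eq₀ eq₁ eq₂ bound

-- Bounds on norms and on argument lists.

norm-≤ : ∀ g {n m} → (∀ y → ∥ y ∥ ≤ n → ∥ g y ∥ ≤ m) → norm g n ≤ m
norm-≤ g {n} {m} g≤m = max≤v⁺ z≤n (All.map⁺ (All.applyUpTo⁺₁ id (2 ^ n) (λ {i} i<2^n → g≤m i (<2^⇒∥∥≤ i<2^n))))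

width : Vec ℕ n → ℕ
width []       = 0
width (x ∷ xs) = x ⊠ width xs

lookup-width : ∀ (xs : Vec ℕ n) i → ∥ lookup xs i ∥ ≤ ∥ width xs ∥
lookup-width (x ∷ xs) zero    = ∥⊠∥≥ˡ x (width xs)
lookup-width (x ∷ xs) (suc i) = ≤-trans (lookup-width xs i) (∥⊠∥≥ʳ x (width xs))

width-BF : {E : Fn m} {T : (ℕ → ℕ) → Vec ℕ m → Vec ℕ n} → BF E → BFs T → BF (λ f v → width (T f v))
width-BF {n = zero} {T = T} e t = BF-resp (λ f v → empty (T f v)) (zero-BF e)
  where
  empty : ∀ (xs : Vec ℕ 0) → 0 ≡ width xs
  empty [] = refl
width-BF {n = suc n} {T = T} e t = BF-resp (λ f v → nonempty (T f v)) (⊠-BF (head-BF t) (width-BF e (tail-BFs t)))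
  where
  nonempty : ∀ (xs : Vec ℕ (suc n)) → head xs ⊠ width (tail xs) ≡ width xs
  nonempty (_ ∷ _) = refl

-- Levels of guessed queries

-- A context of level d is q_d ∷ … ∷ q₁ ∷ zs, where q_{j+1} is the guessed query
-- for the norm at ∥ U j ∥: answers to queries of length at most ∥ U j ∥ are
-- guessed to be no longer than M f q_{j+1}.  Since ∥ M f q ∥ ≥ 2 * ∥ f q ∥, each
-- refuted guess is replaced by one whose answer is more than twice as long.
module Levels (N : ℕ) where

  M : (ℕ → ℕ) → ℕ → ℕ
  M f q = f q ⊠ f q

  -- Each level pays for one operation of a polynomial: the square of the previous bound covers sums
  -- and products, the factor `M` an application of the norm.
  U : ∀ d → Fn (d + N)
  U zero    f v = width v
  U (suc d) f v = (U d f (tail v) ⊠ U d f (tail v)) ⊠ M f (head v)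

  bad : ∀ d → Fn (1 + (d + N))
  bad zero    f v = 0
  bad (suc d) f v =
    ite (bad d f (head v ∷ tail (tail v)))
      (ite (shiftʳ (head v) (U d f (tail (tail v)))) (shiftʳ (f (head v)) (M f (head (tail v)))) 0)
      1

  bad-suc : ∀ d f q v → bad (suc d) f (q ∷ v) ≢ 0 →
    bad d f (q ∷ tail v) ≢ 0 ⊎ (∥ q ∥ ≤ ∥ U d f (tail v) ∥ × ∥ M f (head v) ∥ < ∥ f q ∥)
  bad-suc d f q v b with bad d f (q ∷ tail v)
  ... | suc _ = inj₁ λ ()
  ... | zero with shiftʳ q (U d f (tail v)) in eq
  ...   | suc _ = contradiction refl b
  ...   | zero with shiftʳ (f q) (M f (head v)) in eq′
  ...     | suc _ = inj₂ (shiftʳ≡0⇒≤ {q} eq , shiftʳ≢0⇒> {f q} eq′)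
  ...     | zero  = contradiction refl b

  not-bad-suc : ∀ d f q v → bad (suc d) f (q ∷ v) ≡ 0 →
    bad d f (q ∷ tail v) ≡ 0 × (∥ q ∥ ≤ ∥ U d f (tail v) ∥ → ∥ f q ∥ ≤ ∥ M f (head v) ∥)
  not-bad-suc d f q v ok with bad d f (q ∷ tail v)
  ... | zero = refl , λ q≤U → shiftʳ≡0⇒≤ {f q}
    (subst (λ z → ite z (shiftʳ (f q) (M f (head v))) 0 ≡ 0) (≤⇒shiftʳ≡0 {q} q≤U) ok)

  U-mono : ∀ d f v → ∥ U d f (tail v) ∥ ≤ ∥ U (suc d) f v ∥
  U-mono d f v = ≤-trans (∥⊠∥≥ˡ u u) (∥⊠∥≥ˡ (u ⊠ u) (M f (head v)))
    where u = U d f (tail v)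

  bad-bounded : ∀ d f v q → bad d f (q ∷ v) ≢ 0 → ∥ q ∥ ≤ ∥ U d f v ∥
  bad-bounded zero    f v q b = contradiction refl b
  bad-bounded (suc d) f v q b with bad-suc d f q v b
  ... | inj₁ b′        = ≤-trans (bad-bounded d f (tail v) q b′) (U-mono d f v)
  ... | inj₂ (q≤U , _) = ≤-trans q≤U (U-mono d f v)

  -- The bounds are computed from `f`, while the norm to be bounded is that of the modified function
  -- `g`: the guesses made for `f` have to be right for `g`.
  Controlled : ∀ d → (ℕ → ℕ) → Vec ℕ (d + N) → (ℕ → ℕ) → Vec ℕ n → Set
  Controlled zero    f v g ns = ∀ i → lookup ns i ≤ ∥ U 0 f v ∥
  Controlled (suc d) f v g ns = Controlled d f (tail v) g ns ×
    (∀ q → ∥ q ∥ ≤ ∥ U d f (tail v) ∥ → ∥ g q ∥ ≤ ∥ M f (head v) ∥)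

  -- A query that is not bad respects the guess of every level, and the answer 0 has length 0.
  masked-Controlled : ∀ d f v g (ns : Vec ℕ n) → (∀ i → lookup ns i ≤ ∥ width (drop d v) ∥) →
    (∀ q → g q ≡ 0 ⊎ (bad d f (q ∷ v) ≡ 0 × g q ≡ f q)) → Controlled d f v g ns
  masked-Controlled zero    f v        g ns ns≤ masked = ns≤
  masked-Controlled (suc d) f (q₀ ∷ v) g ns ns≤ masked =
    masked-Controlled d f v g ns ns≤ (λ q → below q (masked q)) , λ q q≤U → short q q≤U (masked q)
    where
    below : ∀ q → g q ≡ 0 ⊎ (bad (suc d) f (q ∷ q₀ ∷ v) ≡ 0 × g q ≡ f q) →
            g q ≡ 0 ⊎ (bad d f (q ∷ v) ≡ 0 × g q ≡ f q)
    below q (inj₁ eq)        = inj₁ eq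
    below q (inj₂ (ok , eq)) = inj₂ (proj₁ (not-bad-suc d f q (q₀ ∷ v) ok) , eq)
    short : ∀ q → ∥ q ∥ ≤ ∥ U d f v ∥ → g q ≡ 0 ⊎ (bad (suc d) f (q ∷ q₀ ∷ v) ≡ 0 × g q ≡ f q) →
            ∥ g q ∥ ≤ ∥ M f q₀ ∥
    short q q≤U (inj₁ eq)        = subst (λ z → ∥ z ∥ ≤ ∥ M f q₀ ∥) (sym eq) z≤n
    short q q≤U (inj₂ (ok , eq)) =
      subst (λ z → ∥ z ∥ ≤ ∥ M f q₀ ∥) (sym eq) (proj₂ (not-bad-suc d f q (q₀ ∷ v) ok) q≤U)

  -- A constant `c` costs `c` levels because each level lengthens the bound by at least one, as
  -- `d≤∥U∥` shows.
  depth : SOPoly 1 n → ℕ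
  depth (const c) = c
  depth (var i)   = 0
  depth (A ⊕ B)   = suc (depth A ⊔ depth B)
  depth (A ⊗ B)   = suc (depth A ⊔ depth B)
  depth (app i A) = suc (depth A)

  d≤∥U∥ : ∀ d f v → d ≤ ∥ U d f v ∥
  d≤∥U∥ zero    f v = z≤n
  d≤∥U∥ (suc d) f v = ≤-trans (s≤s (d≤∥U∥ d f (tail v)))
    (≤-trans (∥⊠∥>ˡ u u) (∥⊠∥≥ˡ (u ⊠ u) (M f (head v))))
    where u = U d f (tail v)

  product-≤ : ∀ u w {a b} → a ≤ ∥ u ∥ → b ≤ ∥ u ∥ → a * b ≤ ∥ (u ⊠ u) ⊠ w ∥
  product-≤ u w {a} {b} a≤u b≤u = begin
    a * b                     ≤⟨ *-mono-≤ (m≤n⇒m≤1+n a≤u) (m≤n⇒m≤1+n b≤u) ⟩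
    suc ∥ u ∥ * suc ∥ u ∥     ≤⟨ n≤1+n _ ⟩
    suc (suc ∥ u ∥ * suc ∥ u ∥) ≡⟨ ∥⊠∥ u u ⟨
    ∥ u ⊠ u ∥                 ≤⟨ ∥⊠∥≥ˡ (u ⊠ u) w ⟩
    ∥ (u ⊠ u) ⊠ w ∥           ∎
    where open ≤-Reasoning

  sum-≤ : ∀ u w {a b} → a ≤ ∥ u ∥ → b ≤ ∥ u ∥ → a + b ≤ ∥ (u ⊠ u) ⊠ w ∥
  sum-≤ u w a≤u b≤u = ≤-trans (+-mono-≤ a≤u b≤u) (≤-trans (∥⊠∥≥+ u u) (∥⊠∥≥ˡ (u ⊠ u) w))

  eval-≤ : ∀ (A : SOPoly 1 n) d → depth A ≤ d → ∀ f v g ns → Controlled d f v g ns →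
           eval A [ norm g ] ns ≤ ∥ U d f v ∥
  eval-≤ (const c) d c≤d f v g ns κ = ≤-trans c≤d (d≤∥U∥ d f v)
  eval-≤ (var i) zero    _ f v g ns κ       = κ i
  eval-≤ (var i) (suc d) _ f v g ns (κ , _) = ≤-trans (eval-≤ (var i) d z≤n f (tail v) g ns κ) (U-mono d f v)
  eval-≤ (A ⊕ B) (suc d) (s≤s A⊔B≤d) f v g ns (κ , _) = sum-≤ (U d f (tail v)) (M f (head v))
    (eval-≤ A d (≤-trans (m≤m⊔n _ _) A⊔B≤d) f (tail v) g ns κ)
    (eval-≤ B d (≤-trans (m≤n⊔m (depth A) _) A⊔B≤d) f (tail v) g ns κ)
  eval-≤ (A ⊗ B) (suc d) (s≤s A⊔B≤d) f v g ns (κ , _) = product-≤ (U d f (tail v)) (M f (head v))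
    (eval-≤ A d (≤-trans (m≤m⊔n _ _) A⊔B≤d) f (tail v) g ns κ)
    (eval-≤ B d (≤-trans (m≤n⊔m (depth A) _) A⊔B≤d) f (tail v) g ns κ)
  -- The inner value is at most the length of `U d`, and up to that length the guess bounds the
  -- answers of `g`.
  eval-≤ (app zero A) (suc d) (s≤s A≤d) f v g ns (κ , short) = ≤-trans
    (norm-≤ g λ y y≤ → short y (≤-trans y≤ (eval-≤ A d A≤d f (tail v) g ns κ)))
    (∥⊠∥≥ʳ (U d f (tail v) ⊠ U d f (tail v)) (M f (head v)))

  module _ {E : Fn N} (e : BF E) where

    M-BF : {A : Fn n} → BF A → BF (λ f v → M f (A f v))
    M-BF a = ⊠-BF (apply-BF a) (apply-BF a)

    U-BF : ∀ d → BF (U d)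
    U-BF zero    = width-BF e id-BFs
    U-BF (suc d) = ⊠-BF (⊠-BF u u) (M-BF (head-BF id-BFs))
      where u = sub (U-BF d) (tail-BFs id-BFs)

    bad-BF : ∀ d → BF (bad d)
    bad-BF zero    = zero-BF (var-BF zero)
    bad-BF (suc d) = ite-BF
      (ite-BF (shiftʳ-BF (apply-BF q) (M-BF (head-BF (tail-BFs id-BFs)))) (zero-BF q)
        (shiftʳ-BF q (sub (U-BF d) v)))
      (BF-resp (λ _ _ → refl) (double+1-BF (zero-BF q)))
      (sub (bad-BF d) (q ∷ᵇ v))
      where
      q = head-BF id-BFs
      v = tail-BFs (tail-BFs id-BFs)

-- Truncated recursion.

module Truncated {l} {G : Fn l} {H : Fn (2 + l)} where

  check : ℕ → ℕ → ℕ
  check b v = ite (shiftʳ v b) (1 + 2 * v) 0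

  check-bounded : ∀ b v → ∥ check b v ∥ ≤ ∥ 1 + 2 * b ∥
  check-bounded b v with shiftʳ v b in eq
  ... | zero  = subst₂ _≤_ (sym (∥1+2*∥ v)) (sym (∥1+2*∥ b)) (s≤s (shiftʳ≡0⇒≤ {v} eq))
  ... | suc _ = z≤n

  check-ok : ∀ b v → ∥ v ∥ ≤ ∥ b ∥ → check b v ≡ 1 + 2 * v
  check-ok b v v≤b = ite-zero (≤⇒shiftʳ≡0 {v} v≤b)

  check-sound : ∀ b v → check b v ≡ 0 ⊎ check b v ≡ 1 + 2 * v
  check-sound b v with shiftʳ v b
  ... | zero  = inj₂ refl
  ... | suc _ = inj₁ refl

  step : (ℕ → ℕ) → ℕ → Vec ℕ l → ℕ → ℕ → ℕ
  step f b xs y r = ite r 0 (check b (H f (y ∷ ⌊ r /2⌋ ∷ xs)))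

  -- The recursion aborts with result 0 as soon as a value is longer than b;
  -- otherwise a value v is represented by 1 + 2 * v.
  truncated : (ℕ → ℕ) → ℕ → Vec ℕ l → ℕ → ℕ
  truncated f b xs = brec (step f b xs) (check b (G f xs))

  truncated-bounded : ∀ f b xs y → ∥ truncated f b xs y ∥ ≤ ∥ 1 + 2 * b ∥
  truncated-bounded f b xs = half-induction _ (check-bounded b _)
    λ y _ → subst (λ z → ∥ z ∥ ≤ ∥ 1 + 2 * b ∥) (sym (brec-suc (step f b xs) _ y))
      (step-bounded (suc y) (truncated f b xs ⌊ suc y /2⌋))
    where
    step-bounded : ∀ y r → ∥ step f b xs y r ∥ ≤ ∥ 1 + 2 * b ∥
    step-bounded y zero    = z≤n
    step-bounded y (suc r) = check-bounded b (H f (y ∷ ⌊ suc r /2⌋ ∷ xs))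

  truncated-BF : BF G → BF H →
    BF (λ f v → truncated f (head (tail v)) (tail (tail v)) (head v))
  truncated-BF g h = brec-BF (head-BF id-BFs) (check-BF b (sub g xs))
    (ite-BF (zero-BF b′) (check-BF b′ (sub h (y ∷ᵇ half-BF r ∷ᵇ sub-BFs xs ctx))) r)
    (double+1-BF (sub b (tail-BFs id-BFs)))
    λ f v → truncated-bounded f (head (tail v)) (tail (tail v))
    where
    check-BF : ∀ {n} {B V : Fn n} → BF B → BF V → BF (λ f v → check (B f v) (V f v))
    check-BF b v = ite-BF (double+1-BF v) (zero-BF v) (shiftʳ-BF v b)
    b : BF {2 + l} (λ f v → head (tail v))
    b = head-BF (tail-BFs id-BFs)
    xs : BFs {2 + l} (λ f v → tail (tail v))
    xs = tail-BFs (tail-BFs id-BFs)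
    y : BF {4 + l} (λ f v → head v)
    y = head-BF id-BFs
    r : BF {4 + l} (λ f v → head (tail v))
    r = head-BF (tail-BFs id-BFs)
    ctx : BFs {4 + l} (λ f v → tail (tail v))
    ctx = tail-BFs (tail-BFs id-BFs)
    b′ = sub b ctx

  module _ (F : Fn (1 + l)) (F-zero : ∀ f xs → F f (0 ∷ xs) ≡ G f xs)
           (F-suc : ∀ f xs y → F f (suc y ∷ xs) ≡ H f (suc y ∷ F f (⌊ suc y /2⌋ ∷ xs) ∷ xs)) where

    truncated-step : ∀ f b xs y → truncated f b xs ⌊ suc y /2⌋ ≡ 1 + 2 * F f (⌊ suc y /2⌋ ∷ xs) →
                     truncated f b xs (suc y) ≡ check b (F f (suc y ∷ xs))
    truncated-step f b xs y eq = begin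
      truncated f b xs (suc y)                               ≡⟨ brec-suc (step f b xs) (check b (G f xs)) y ⟩
      step f b xs (suc y) (truncated f b xs ⌊ suc y /2⌋)     ≡⟨ cong (step f b xs (suc y)) eq ⟩
      check b (H f (suc y ∷ ⌊ 1 + 2 * p /2⌋ ∷ xs))
        ≡⟨ cong (λ z → check b (H f (suc y ∷ z ∷ xs))) (half-1+2* p) ⟩
      check b (H f (suc y ∷ p ∷ xs))                         ≡⟨ cong (check b) (F-suc f xs y) ⟨
      check b (F f (suc y ∷ xs))                             ∎
      where
      open ≡-Reasoning
      p = F f (⌊ suc y /2⌋ ∷ xs)

    truncated-complete : ∀ f b xs n → (∀ y → y ≤ n → ∥ F f (y ∷ xs) ∥ ≤ ∥ b ∥) →
                         truncated f b xs n ≡ 1 + 2 * F f (n ∷ xs)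
    truncated-complete f b xs n short = half-induction
      (λ y → y ≤ n → truncated f b xs y ≡ 1 + 2 * F f (y ∷ xs))
      (λ 0≤n → trans (cong (check b) (sym (F-zero f xs))) (check-ok b _ (short 0 0≤n)))
      (λ y ih y<n → trans (truncated-step f b xs y (ih (≤-trans (⌊n/2⌋≤n (suc y)) y<n)))
        (check-ok b _ (short (suc y) y<n)))
      n ≤-refl

    -- Truncation never alters a value: it only aborts, and an abort persists as 0.
    truncated-sound : ∀ f b xs y → truncated f b xs y ≡ 0 ⊎ truncated f b xs y ≡ 1 + 2 * F f (y ∷ xs)
    truncated-sound f b xs = half-induction _
      (subst (λ z → check b (G f xs) ≡ 0 ⊎ check b (G f xs) ≡ 1 + 2 * z) (sym (F-zero f xs)) (check-sound b (G f xs)))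
      λ { y (inj₁ eq) → inj₁ (trans (brec-suc (step f b xs) (check b (G f xs)) y) (cong (step f b xs (suc y)) eq))
        ; y (inj₂ eq) → subst (λ z → z ≡ 0 ⊎ z ≡ 1 + 2 * F f (suc y ∷ xs)) (sym (truncated-step f b xs y eq))
                          (check-sound b (F f (suc y ∷ xs))) }

-- Eliminating the guesses level by level.

module Search {l} {G : Fn l} {H : Fn (2 + l)} {F : Fn (1 + l)} (G-BF : BF G) (H-BF : BF H)
  (F-zero : ∀ f xs → F f (0 ∷ xs) ≡ G f xs)
  (F-suc : ∀ f xs y → F f (suc y ∷ xs) ≡ H f (suc y ∷ F f (⌊ suc y /2⌋ ∷ xs) ∷ xs))
  (Q : SOPoly 1 (l + 1))
  (F-bounded : ∀ f xs y → ∥ F f (y ∷ xs) ∥ ≤ eval Q [ norm f ] (map ∥_∥ (xs ++ y ∷ []))) where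

  open Levels (1 + l)
  open Truncated {l} {G} {H} using (truncated; truncated-BF; truncated-complete; truncated-sound)

  private
    pos : BF {1 + l} (λ _ v → lookup v zero)
    pos = var-BF zero

  -- Parity separates the outcomes: even for the value of `F`, odd for a query refuting the guesses.
  Answer : ∀ d → (ℕ → ℕ) → Vec ℕ (d + (1 + l)) → ℕ → Set
  Answer d f v w = w ≡ 2 * F f (drop d v) ⊎ (∃ λ q → w ≡ 1 + 2 * q × bad d f (q ∷ v) ≢ 0)

  -- At level `depth Q` all guesses are supplied; each descent by a level finds one of them by
  -- search. At level 0 no query is bad, so only the value of `F` is left.
  Solvable : ℕ → Set
  Solvable d = ∃ λ (V : Fn (d + (1 + l))) → BF V × (∀ f v → Answer d f v (V f v))

  lengths-≤ : ∀ {n} (xs : Vec ℕ n) z b → (∀ i → ∥ lookup xs i ∥ ≤ b) → ∥ z ∥ ≤ b →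
              ∀ i → lookup (map ∥_∥ (xs ++ z ∷ [])) i ≤ b
  lengths-≤ []       z b xs≤b z≤b zero    = z≤b
  lengths-≤ (x ∷ xs) z b xs≤b z≤b zero    = xs≤b zero
  lengths-≤ (x ∷ xs) z b xs≤b z≤b (suc i) = lengths-≤ xs z b (xs≤b ∘ suc) z≤b i

  solvable-depth : Solvable (depth Q)
  solvable-depth = V , V-BF , answer
    where
    d = depth Q
    open Trace (bad d) (U d) (bad-BF pos d) (U-BF pos d) (bad-bounded d)
    open Traced (traced (unbf (truncated-BF G-BF H-BF)))

    args : (ℕ → ℕ) → Vec ℕ (d + (1 + l)) → Vec ℕ (2 + l)
    args f v = head (drop d v) ∷ U d f v ∷ tail (drop d v)

    T : Fn (d + (1 + l))
    T f v = truncated f (U d f v) (tail (drop d v)) (head (drop d v))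

    V : Fn (d + (1 + l))
    -- A correct run yields `1 + 2 * F`; halving and doubling turn it into the even answer.
    V f v = trace f v (args f v) orElse (2 * ⌊ T f v /2⌋)

    args-BFs : BFs args
    args-BFs = head-BF (drop-BFs d) ∷ᵇ U-BF pos d ∷ᵇ tail-BFs (drop-BFs d)

    V-BF : BF V
    V-BF = ite-BF (double-BF (half-BF (sub (truncated-BF G-BF H-BF) args-BFs))) w w
      where w = sub₂ {W = trace} trace-BF id-BFs args-BFs

    mask : (ℕ → ℕ) → Vec ℕ (d + (1 + l)) → ℕ → ℕ
    mask f v q = ite (bad d f (q ∷ v)) (f q) 0

    mask-agrees : ∀ f v → Agree f v (mask f v)
    mask-agrees f v q = ite-zero

    mask-cases : ∀ f v q → mask f v q ≡ 0 ⊎ (bad d f (q ∷ v) ≡ 0 × mask f v q ≡ f q)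
    mask-cases f v q with bad d f (q ∷ v)
    ... | zero  = inj₂ (refl , refl)
    ... | suc _ = inj₁ refl

    -- The bound `Q` is assumed for every function, hence also for the masked one. For that one all
    -- guesses are right, so the value of `Q` stays below the computed bound.
    mask-short : ∀ f v y xs → drop d v ≡ y ∷ xs → ∀ z → z ≤ y → ∥ F (mask f v) (z ∷ xs) ∥ ≤ ∥ U d f v ∥
    mask-short f v y xs eq z z≤y = ≤-trans (F-bounded (mask f v) xs z)
      (eval-≤ Q d ≤-refl f v (mask f v) ns (masked-Controlled d f v (mask f v) ns ns≤ (mask-cases f v)))
      where
      ns = map ∥_∥ (xs ++ z ∷ [])
      ns≤ : ∀ i → lookup ns i ≤ ∥ width (drop d v) ∥
      ns≤ rewrite eq = lengths-≤ xs z _ (λ i → lookup-width (y ∷ xs) (suc i))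
        (≤-trans (∥∥-mono z≤y) (lookup-width (y ∷ xs) zero))

    -- The run for the masked function is never truncated. Since the run for `f` has the same
    -- result, it was not aborted either, and an unaborted run is correct.
    T-correct : ∀ f v zs → drop d v ≡ zs →
      truncated (mask f v) (U d f v) (tail zs) (head zs) ≡ truncated f (U d f v) (tail zs) (head zs) →
      truncated f (U d f v) (tail zs) (head zs) ≡ 1 + 2 * F f zs
    T-correct f v (y ∷ xs) eq same with truncated-sound F F-zero F-suc f (U d f v) xs y
    ... | inj₂ eq′ = eq′
    ... | inj₁ eq′ = contradiction (begin
      1 + 2 * F (mask f v) (y ∷ xs)         ≡⟨ truncated-complete F F-zero F-suc (mask f v) (U d f v) xs y (mask-short f v y xs eq) ⟨
      truncated (mask f v) (U d f v) xs y   ≡⟨ same ⟩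
      truncated f (U d f v) xs y            ≡⟨ eq′ ⟩
      0                                     ∎) λ ()
      where open ≡-Reasoning

    same-run : ∀ f v → (∀ g → Agree f v g → truncated g (U d f v) (tail (drop d v)) (head (drop d v)) ≡ T f v) →
               T f v ≡ 1 + 2 * F f (drop d v)
    same-run f v insensitive = T-correct f v (drop d v) refl (insensitive (mask f v) (mask-agrees f v))

    conclude : ∀ f v {w} → Unless f v w (T f v ≡ 1 + 2 * F f (drop d v)) →
               Answer d f v (w orElse (2 * ⌊ T f v /2⌋))
    conclude f v (inj₁ (refl , eq))    = inj₁ (cong (2 *_) (trans (cong ⌊_/2⌋ eq) (half-1+2* (F f (drop d v)))))
    conclude f v (inj₂ (q , refl , b)) = inj₂ (q , refl , b)

    answer : ∀ f v → Answer d f v (V f v)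
    answer f v = conclude f v (map-Unless (same-run f v) (traces f v (args f v)))

  solvable-pred : ∀ d → Solvable (suc d) → Solvable d
  solvable-pred d (V′ , V′-BF , answer′) = V , V-BF , answer
    where
    -- Only a query refuting the newest guess `q` replaces it. Any other reported query is bad at
    -- level `d` by `bad-suc`, hence already an answer there, and `q` is kept.
    s : (ℕ → ℕ) → Vec ℕ (d + (1 + l)) → ℕ → ℕ
    s f v q = ite (odd w) q (ite (shiftʳ h (U d f v)) (ite (shiftʳ (f h) (M f q)) q h) q)
      where
      w = V′ f (q ∷ v)
      h = ⌊ w /2⌋

    Final : (ℕ → ℕ) → Vec ℕ (d + (1 + l)) → ℕ → Set
    Final f v q = Answer d f v (V′ f (q ∷ v))

    -- A query refuting `q` has an answer longer than `M f q`, whose length is at least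
    -- `2 * ∥ f q ∥`: this is the factor 2 in `iterate-twice`.
    improve : ∀ f v q → (Final f v q × s f v q ≡ q) ⊎ (∥ s f v q ∥ ≤ ∥ U d f v ∥ × 2 * ∥ f q ∥ < ∥ f (s f v q) ∥)
    improve f v q with V′ f (q ∷ v) | answer′ f (q ∷ v)
    ... | w | inj₁ refl = inj₁ (inj₁ refl , ite-zero (odd-2* (F f (drop d v))))
    ... | w | inj₂ (q′ , refl , b) rewrite odd-1+2* q′ | half-1+2* q′
      with shiftʳ q′ (U d f v) in eq | shiftʳ (f q′) (M f q) in eq′ | bad-suc d f q′ (q ∷ v) b
    ... | zero  | suc _ | _ = inj₂ (shiftʳ≡0⇒≤ {q′} eq ,
      ≤-<-trans (≤-trans (≤-reflexive (cong (∥ f q ∥ +_) (+-identityʳ _))) (∥⊠∥≥+ (f q) (f q))) (shiftʳ≢0⇒> {f q′} eq′))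
    ... | suc _ | _     | inj₁ b′ = inj₁ (inj₂ (q′ , refl , b′) , refl)
    ... | zero  | zero  | inj₁ b′ = inj₁ (inj₂ (q′ , refl , b′) , refl)
    ... | suc _ | _     | inj₂ (q′≤U , _) = contradiction (trans (sym (≤⇒shiftʳ≡0 {q′} q′≤U)) eq) λ ()
    ... | zero  | zero  | inj₂ (_ , M<f)  = contradiction (shiftʳ≡0⇒≤ {f q′} eq′) (<⇒≱ M<f)

    -- A step keeps the guess or replaces it by a query no longer than `U d`, so lengths do not
    -- accumulate and one bound serves the whole iteration.
    s-bounded : ∀ f v q y → ∥ brec (λ _ → s f v) q y ∥ ≤ ∥ U d f v ⊠ q ∥
    s-bounded f v q = half-induction _ (∥⊠∥≥ʳ (U d f v) q) λ y ih →
      subst (λ z → ∥ z ∥ ≤ ∥ U d f v ⊠ q ∥) (sym (brec-suc (λ _ → s f v) q y)) (step _ ih)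
      where
      step : ∀ r → ∥ r ∥ ≤ ∥ U d f v ⊠ q ∥ → ∥ s f v r ∥ ≤ ∥ U d f v ⊠ q ∥
      step r r≤ with improve f v r
      ... | inj₁ (_ , eq)  = subst (λ z → ∥ z ∥ ≤ _) (sym eq) r≤
      ... | inj₂ (s≤U , _) = ≤-trans s≤U (∥⊠∥≥ˡ (U d f v) q)

    iterations : Fn (d + (1 + l))
    -- The length is `2 + ∥ U d f v ∥`, the number of first steps that `iterate-twice` asks for.
    iterations f v = 1 + 2 * (1 + 2 * U d f v)

    q₁ q₂ V : Fn (d + (1 + l))
    q₁ f v = brec (λ _ → s f v) 0 (iterations f v)
    -- Recursion along the answer to `q₁` makes as many steps as that answer has digits.
    q₂ f v = brec (λ _ → s f v) (q₁ f v) (f (q₁ f v))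
    V  f v = V′ f (q₂ f v ∷ v)

    answer : ∀ f v → Answer d f v (V f v)
    answer f v = subst (Final f v) (sym q₂≡)
      (iterate-twice (s f v) (∥_∥ ∘ f) (Final f v) (∥ U d f v ∥) (improve f v) 0 (∥ iterations f v ∥)
        (≤-reflexive (sym (trans (∥1+2*∥ (1 + 2 * U d f v)) (cong suc (∥1+2*∥ (U d f v)))))))
      where
      q₂≡ : q₂ f v ≡ iter (s f v) (iter (s f v) 0 (∥ iterations f v ∥)) (∥ f (iter (s f v) 0 (∥ iterations f v ∥)) ∥)
      q₂≡ = trans (brec≡iter (s f v) (q₁ f v) (f (q₁ f v)))
        (cong (λ q → iter (s f v) q (∥ f q ∥)) (brec≡iter (s f v) 0 (iterations f v)))

    u = U-BF pos d

    iterate-BF : {E C : Fn (d + (1 + l))} → BF E → BF C → BF (λ f v → brec (λ _ → s f v) (E f v) (C f v))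
    iterate-BF {E} e c = brec-BF c e s-BF (⊠-BF (sub u (tail-BFs id-BFs)) (sub e (tail-BFs id-BFs)))
      (λ f v → s-bounded f v (E f v))
      where
      s-BF : BF (λ f w → s f (tail (tail w)) (head (tail w)))
      s-BF = ite-BF q (ite-BF (ite-BF q h (shiftʳ-BF (apply-BF h) (M-BF pos q))) q (shiftʳ-BF h (sub u v))) (odd-BF w)
        where
        q = head-BF (tail-BFs id-BFs)
        v = tail-BFs (tail-BFs id-BFs)
        w = sub V′-BF (q ∷ᵇ v)
        h = half-BF w

    q₁-BF : BF q₁
    q₁-BF = iterate-BF (zero-BF u) (double+1-BF (double+1-BF u))

    V-BF : BF V
    V-BF = sub V′-BF (iterate-BF q₁-BF (apply-BF q₁-BF) ∷ᵇ id-BFs)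

  solvable-zero : ∀ d → Solvable d → Solvable 0
  solvable-zero zero    V = V
  solvable-zero (suc d) V = solvable-zero d (solvable-pred d V)

  solution : Solvable 0 → BF F
  solution (V , V-BF , answer) = BF-resp (λ f v → value f v (answer f v)) (half-BF V-BF)
    where
    value : ∀ f v {w} → Answer 0 f v w → ⌊ w /2⌋ ≡ F f v
    value f v (inj₁ eq)          = trans (cong ⌊_/2⌋ eq) (half-2* (F f v))
    value f v (inj₂ (_ , _ , b)) = contradiction refl b

  F-BF : BF F
  F-BF = solution (solvable-zero (depth Q) solvable-depth)

-- Polynomially bounded recursion on notation.

theorem8 : ∀ {l : ℕ}
    (G : Functional 1 l) (H : Functional 1 (l + 2)) (Q : SOPoly 1 (l + 1))
    (F : Functional 1 (l + 1)) →
    BFF G → BFF H →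
    (∀ (f : ℕ → ℕ) (xs : Vec ℕ l) → F [ f ] (xs ++ 0 ∷ []) ≡ G [ f ] xs) →
    (∀ (f : ℕ → ℕ) (xs : Vec ℕ l) (y : ℕ) → y > 0 →
    F [ f ] (xs ++ y ∷ []) ≡ H [ f ] (xs ++ F [ f ] (xs ++ ⌊ y /2⌋ ∷ []) ∷ y ∷ [])) →
    (∀ (f : ℕ → ℕ) (xs : Vec ℕ l) (y : ℕ) →
    ∥ F [ f ] (xs ++ y ∷ []) ∥ ≤ eval Q [ norm f ] (map ∥_∥ (xs ++ y ∷ []))) →
    BFF F
theorem8 {l} G H Q F G-BFF H-BFF F-zero F-suc F-bounded = resp
  (λ { (f ∷ []) v → cong (F [ f ]) (rejoin v) })
  (unbf (sub F-BF (head-BF (drop-BFs l) ∷ᵇ take-BFs l)))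
  where
  wrap : {E : Functional 1 n} → BFF E → BF (λ f v → E [ f ] v)
  wrap E = bf (resp (λ { (_ ∷ []) _ → refl }) E)
  -- `Search` has the recursion variable in front and gives the step the number before the previous
  -- value, so the arguments are rearranged.
  open Search
    {G = λ f → G [ f ]}
    {H = λ f v → H [ f ] (tail (tail v) ++ head (tail v) ∷ head v ∷ [])}
    {F = λ f v → F [ f ] (tail v ++ head v ∷ [])}
    (wrap G-BFF)
    (sub (wrap H-BFF) (tail-BFs (tail-BFs id-BFs) ++ᵇ head-BF (tail-BFs id-BFs) ∷ᵇ head-BF id-BFs ∷ᵇ []ᵇ))
    F-zero (λ f xs y → F-suc f xs (suc y) (s≤s z≤n)) Q F-bounded
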